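{- For strictly positive formulas $A,B$, $A\vdash_{\mathbf{RC\omega}}B$ iff $\mathrm{RC}\omega_S[A]\Vdash B$ (truth at the root), where $S=\ell(\{A,B\})$.
   Context: Strictly positive formulas: $A::= p\mid \top\mid (A\land B)\mid \alpha A$, $\alpha\le\omega$; $\ell(X)$ is the set of modalities occurring in formulas of $X$. $\mathbf{RC\omega}$: $A\vdash A$; $A\vdash\top$; cut; $A\land B\vdash A$; $A\land B\vdash B$; from $A\vdash B$, $A\vdash C$ infer $A\vdash B\land C$; from $A\vdash B$ infer $\alpha A\vdash\alpha B$; $\alpha\alpha A\vdash\alpha A$; $\alpha\beta A\vdash\beta A$, $\beta\alpha A\vdash\beta A$ for $\alpha\ge\beta$; $\alpha A\land\beta B\vdash\alpha(A\land\beta B)$ for $\alpha>\beta$; $\alpha A\vdash\beta A$ for $\alpha>\beta$; $\omega A\vdash A$. Kripke models of signature $S$: $W$, relations $(R_\alpha)_{\alpha\in S}$, valuation $v$; $x\Vdash\alpha A$ iff $\exists y(xR_\alpha y\wedge y\Vdash A)$. RC$_S$-frame: for $\alpha,\beta\in S$, $R_\alpha R_\beta\subseteq R_{\min(\alpha,\beta)}$; for $\alpha>\beta$, $xR_\alpha y\wedge xR_\beta z\Rightarrow yR_\beta z$; and $R_\alpha\subseteq R_\beta$ for $\beta<\alpha$. The canonical tree $T[A]$: for a variable or $\top$, one node with empty relations where only that variable is true; $T[B\land C]$: disjoint union of $T[B],T[C]$ with roots identified, a variable true at the root iff true at either root; $T[\alpha B]$: $T[B]$ plus a new root $r$ (all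 variables false) with $rR_\alpha$(root of $T[B]$). $\mathrm{RC}_S[A]$ ($S\supseteq\ell(A)$) is $T[A]$ with its relations replaced by the least relations containing them that form an RC$_S$-frame. $\mathrm{RC}\omega_S[A]$ has the frame of $\mathrm{RC}_S[A]$ and valuation $v'$ with $v'(x,p)=1$ iff $v(x,p)=1$ or there is $y$ with $xR_\omega y$ and $v(y,p)=1$, where $v$ is the valuation of $\mathrm{RC}_S[A]$. -}

module Defs where

open import Level using (0ℓ)
open import Data.Nat.Base as ℕ using (ℕ)
import Data.Nat.Properties as ℕ
open import Data.Product.Base using (Σ-syntax; ∃-syntax; _×_; _,_)
open import Data.Sum.Base using (_⊎_; inj₁; inj₂)
import Data.Unit.Base as Unit
open import Relation.Binary.Bundles using (TotalOrder)
open import Relation.Binary.Core using (Rel)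
open import Relation.Binary.PropositionalEquality.Core using (sym; subst)
open import Relation.Nullary.Construct.Add.Supremum using (_⁺; ⊤⁺)
open import Relation.Unary using (Pred; _∈_)
import Algebra.Construct.NaturalChoice.Min as Min
import Relation.Binary.Construct.Add.Supremum.NonStrict as NonStrict
import Relation.Binary.Construct.Add.Supremum.Strict as Strict

-- The ordinals α ≤ ω, that is ℕ with a top element.
Modality : Set
Modality = ℕ ⁺

pattern ω = ⊤⁺

open NonStrict ℕ._≤_ public using () renaming (_≤⁺_ to _≤_)
open Strict    ℕ._<_ public using () renaming (_<⁺_ to _<_)

≤-totalOrder : TotalOrder 0ℓ 0ℓ 0ℓ
≤-totalOrder = record
  { isTotalOrder = NonStrict.≤⁺-isTotalOrder-≡ ℕ._≤_ ℕ.≤-isTotalOrder }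

open Min ≤-totalOrder public using (_⊓_; ⊓-sel)

infixr 7 _∧_
infixr 8 ⟨_⟩_

data Formula : Set where
  var  : ℕ → Formula
  ⊤    : Formula
  _∧_  : Formula → Formula → Formula
  ⟨_⟩_ : Modality → Formula → Formula

data OccursIn (α : Modality) : Formula → Set where
  here : ∀ {A}             → OccursIn α (⟨ α ⟩ A)
  dia  : ∀ {β A}           → OccursIn α A → OccursIn α (⟨ β ⟩ A)
  ∧ˡ   : ∀ {A B}           → OccursIn α A → OccursIn α (A ∧ B)
  ∧ʳ   : ∀ {A B}           → OccursIn α B → OccursIn α (A ∧ B)

Signature : Set₁
Signature = Pred Modality 0ℓ

ℓ : Pred Formula 0ℓ → Signature
ℓ X α = ∃[ A ] A ∈ X × OccursIn α A

infix 4 _⊢_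

data _⊢_ : Formula → Formula → Set where
  ⊢-refl  : ∀ {A}       → A ⊢ A
  ⊢-⊤     : ∀ {A}       → A ⊢ ⊤
  ⊢-cut   : ∀ {A B C}   → A ⊢ B → B ⊢ C → A ⊢ C
  ⊢-∧ˡ    : ∀ {A B}     → A ∧ B ⊢ A
  ⊢-∧ʳ    : ∀ {A B}     → A ∧ B ⊢ B
  ⊢-∧     : ∀ {A B C}   → A ⊢ B → A ⊢ C → A ⊢ B ∧ C
  ⊢-nec   : ∀ {α A B}   → A ⊢ B → ⟨ α ⟩ A ⊢ ⟨ α ⟩ B
  ⊢-trans : ∀ {α A}     → ⟨ α ⟩ ⟨ α ⟩ A ⊢ ⟨ α ⟩ A
  ⊢-minʳ  : ∀ {α β A}   → β ≤ α → ⟨ α ⟩ ⟨ β ⟩ A ⊢ ⟨ β ⟩ A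
  ⊢-minˡ  : ∀ {α β A}   → β ≤ α → ⟨ β ⟩ ⟨ α ⟩ A ⊢ ⟨ β ⟩ A
  ⊢-J     : ∀ {α β A B} → β < α → ⟨ α ⟩ A ∧ ⟨ β ⟩ B ⊢ ⟨ α ⟩ (A ∧ ⟨ β ⟩ B)
  ⊢-mono  : ∀ {α β A}   → β < α → ⟨ α ⟩ A ⊢ ⟨ β ⟩ A
  ⊢-ω     : ∀ {A}       → ⟨ ω ⟩ A ⊢ A

-- A family of relations indexed by the elements of S; the membership proof is
-- irrelevant, so there is one relation per element.
Relations : Signature → Set → Set₁
Relations S W = (α : Modality) → .(α ∈ S) → Rel W 0ℓ

record Model (S : Signature) : Set₁ where
  field
    W : Set
    R : Relations S W
    V : W → Pred ℕ 0ℓ   -- V x p is "v(x,p) = 1"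

-- A modality outside S has no relation in M, so ⟨ α ⟩ A is then false; for
-- formulas whose modalities all lie in S the component α ∈ S is no restriction.
Forces : ∀ {S} (M : Model S) → Model.W M → Formula → Set
Forces     M x (var p)   = Model.V M x p
Forces     M x ⊤         = Unit.⊤
Forces     M x (A ∧ B)   = Forces M x A × Forces M x B
Forces {S} M x (⟨ α ⟩ A) =
  Σ[ s ∈ α ∈ S ] ∃[ y ] (Model.R M α s x y × Forces M y A)

infix 4 _,_⊩_
_,_⊩_ : ∀ {S} (M : Model S) → Model.W M → Formula → Set
M , x ⊩ A = Forces M x A

⊓-∈ : ∀ {S : Signature} {α β} → α ∈ S → β ∈ S → α ⊓ β ∈ S
⊓-∈ {S} {α} {β} a b with ⊓-sel α β
... | inj₁ eq = subst S (sym eq) a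
... | inj₂ eq = subst S (sym eq) b

record IsRCFrame (S : Signature) {W : Set} (R : Relations S W) : Set where
  field
    comp : ∀ {α β} .(a : α ∈ S) .(b : β ∈ S) {x y z} →
           R α a x y → R β b y z → R (α ⊓ β) (⊓-∈ {S} a b) x z
    eucl : ∀ {α β} .(a : α ∈ S) .(b : β ∈ S) → β < α → ∀ {x y z} →
           R α a x y → R β b x z → R β b y z
    mono : ∀ {α β} .(a : α ∈ S) .(b : β ∈ S) → β < α → ∀ {x y} →
           R α a x y → R β b x y

data Closure (S : Signature) {W : Set} (R : Relations S W) :
             Modality → Rel W 0ℓ where
  base : ∀ {α} .(a : α ∈ S) {x y} → R α a x y → Closure S R α x y
  comp : ∀ {α β} .(a : α ∈ S) .(b : β ∈ S) {x y z} →
         Closure S R α x y → Closure S R β y z → Closure S R (α ⊓ β) x z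
  eucl : ∀ {α β} .(a : α ∈ S) .(b : β ∈ S) → β < α → ∀ {x y z} →
         Closure S R α x y → Closure S R β x z → Closure S R β y z
  mono : ∀ {α β} .(a : α ∈ S) .(b : β ∈ S) → β < α → ∀ {x y} →
         Closure S R α x y → Closure S R β x y

RCClosure : ∀ {S W} → Relations S W → Relations S W
RCClosure {S} R α _ = Closure S R α

RCClosure-isRCFrame : ∀ {S W} (R : Relations S W) → IsRCFrame S (RCClosure R)
RCClosure-isRCFrame R = record { comp = comp ; eucl = eucl ; mono = mono }

RCClosure-least : ∀ {S W} {R R′ : Relations S W} → IsRCFrame S R′ →
  (∀ {α} .(a : α ∈ S) {x y} → R α a x y → R′ α a x y) →
  ∀ {α} .(a : α ∈ S) {x y} → RCClosure R α a x y → R′ α a x y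
RCClosure-least {S} {R = R} {R′} F R⊆R′ = λ a → go a
  where
  go : ∀ {α} .(a : α ∈ S) {x y} → Closure S R α x y → R′ α a x y
  go _ (base a r)       = R⊆R′ a r
  go _ (comp a b p q)   = IsRCFrame.comp F a b (go a p) (go b q)
  go _ (eucl a b l p q) = IsRCFrame.eucl F a b l (go a p) (go b q)
  go _ (mono a b l p)   = IsRCFrame.mono F a b l (go a p)

-- Nodes of T[A].  Separating the root from the other nodes lets the two roots
-- in T[B ∧ C] be identified without a quotient.
mutual
  data Node (A : Formula) : Set where
    root    : Node A
    nonroot : NonRoot A → Node A

  data NonRoot : Formula → Set where
    left  : ∀ {B C} → NonRoot B → NonRoot (B ∧ C)
    right : ∀ {B C} → NonRoot C → NonRoot (B ∧ C)
    below : ∀ {α B} → Node B → NonRoot (⟨ α ⟩ B)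

inˡ : ∀ {B C} → Node B → Node (B ∧ C)
inˡ root        = root
inˡ (nonroot x) = nonroot (left x)

inʳ : ∀ {B C} → Node C → Node (B ∧ C)
inʳ root        = root
inʳ (nonroot x) = nonroot (right x)

sub : ∀ {α B} → Node B → Node (⟨ α ⟩ B)
sub x = nonroot (below x)

data Edge : (A : Formula) → Modality → Rel (Node A) 0ℓ where
  ∧ˡ  : ∀ {B C α x y} → Edge B α x y → Edge (B ∧ C) α (inˡ x) (inˡ y)
  ∧ʳ  : ∀ {B C α x y} → Edge C α x y → Edge (B ∧ C) α (inʳ x) (inʳ y)
  dia : ∀ {β B α x y} → Edge B α x y → Edge (⟨ β ⟩ B) α (sub x) (sub y)
  new : ∀ {α B}       → Edge (⟨ α ⟩ B) α root (sub root)

data TrueAt : (A : Formula) → Node A → ℕ → Set where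
  var : ∀ {p}         → TrueAt (var p) root p
  ∧ˡ  : ∀ {B C x p}   → TrueAt B x p → TrueAt (B ∧ C) (inˡ x) p
  ∧ʳ  : ∀ {B C x p}   → TrueAt C x p → TrueAt (B ∧ C) (inʳ x) p
  dia : ∀ {α B x p}   → TrueAt B x p → TrueAt (⟨ α ⟩ B) (sub x) p

-- T[A] in signature S.  Meant for S ⊇ ℓ(A), in which case no edge is lost; the
-- relations for α ∈ S not occurring in A are empty.
T : (S : Signature) → Formula → Model S
T S A = record { W = Node A ; R = λ α _ → Edge A α ; V = TrueAt A }

RC : (S : Signature) → Formula → Model S
RC S A = record { W = W ; R = RCClosure R ; V = V }
  where open Model (T S A)

RCω : (S : Signature) → Formula → Model S
RCω S A = record
  { W = W
  ; R = R
  ; V = λ x p → V x p ⊎ (Σ[ s ∈ ω ∈ S ] ∃[ y ] (R ω s x y × V y p))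
  }
  where open Model (RC S A)

{-# OPTIONS --safe #-}
-- In T[A] the closure has an explicit form that does not mention the signature:
-- x R_γ z iff some w reaches x by a path of edges labelled > γ and reaches z by
-- a nonempty path of edges labelled ≥ γ.  Hence a derivation of A ⊢ B, which may
-- use modalities outside S, can be interpreted in the full signature and the
-- result transferred back to S = ℓ({A,B}).
--
-- Conversely, each node of T[A] is given a theory, starting from the consequences
-- of A at the root, in such a way that the canonical relations between these
-- theories form an RC_S-frame containing the edges of T[A].  They then contain
-- the closure, and every formula forced at a node belongs to its theory.
module Submission where

open import Defs
import Data.Nat.Properties as ℕ
open import Data.Product.Base using (Σ-syntax; ∃-syntax; _×_; _,_; proj₁)
open import Data.Sum.Base using (_⊎_; inj₁; inj₂)
open import Data.Unit.Base using (tt)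
open import Function.Base using (_∘_; case_of_)
open import Function.Bundles using (_⇔_; mk⇔)
open import Level using (0ℓ)
open import Relation.Binary.Bundles using (TotalOrder)
open import Relation.Binary.Core using (Rel)
open import Relation.Binary.Definitions using (Transitive; Trans)
open import Relation.Binary.PropositionalEquality.Core using (_≡_; refl; sym; subst; subst₂)
open import Relation.Nullary.Construct.Add.Supremum using ([_])
open import Relation.Unary using (Pred; _∈_; _⊆_; U; _∪_; ｛_｝)
import Algebra.Construct.NaturalChoice.Min as Min
import Relation.Binary.Construct.Add.Supremum.NonStrict as NonStrict
import Relation.Binary.Construct.Add.Supremum.Strict as Strict

open Min ≤-totalOrder using (⊓-idem; x⊓y≤x; x⊓y≤y; x≤y⇒x⊓y≈x; x≤y⇒y⊓x≈x)
open TotalOrder ≤-totalOrder using () renaming (refl to ≤-refl; trans to ≤-trans)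

private
  variable
    A B C : Formula
    α β γ : Modality
    S     : Signature

-- Order on modalities

<-trans : Transitive _<_
<-trans = Strict.<⁺-trans _ ℕ.<-trans

<-≤-trans : Trans _<_ _≤_ _<_
<-≤-trans = Strict.<⁺-transˡ _ ℕ.<-≤-trans

≤-<-trans : Trans _≤_ _<_ _<_
≤-<-trans = Strict.<⁺-transʳ _ ℕ.≤-<-trans

<⇒≤ : α < β → α ≤ β
<⇒≤ Strict.[ p ]     = NonStrict.[ ℕ.<⇒≤ p ]
<⇒≤ Strict.[ k ]<⊤⁺ = _ NonStrict.≤⊤⁺

≤⇒<∨≡ : α ≤ β → α < β ⊎ α ≡ β
≤⇒<∨≡ NonStrict.[ p ] with ℕ.m≤n⇒m<n∨m≡n p
... | inj₁ q    = inj₁ Strict.[ q ]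
... | inj₂ refl = inj₂ refl
≤⇒<∨≡ ([ k ] NonStrict.≤⊤⁺) = inj₁ Strict.[ k ]<⊤⁺
≤⇒<∨≡ (ω NonStrict.≤⊤⁺)     = inj₂ refl

-- Paths and the explicit form of the closure

parent : NonRoot A → Node A
parent (left y)            = inˡ (parent y)
parent (right y)           = inʳ (parent y)
parent (below root)        = root
parent (below (nonroot y)) = sub (parent y)

label : NonRoot A → Modality
label (left y)                = label y
label (right y)               = label y
label {⟨ α ⟩ B} (below root) = α
label (below (nonroot y))     = label y

edge-to : (y : NonRoot A) → Edge A (label y) (parent y) (nonroot y)
edge-to (left y)            = ∧ˡ (edge-to y)
edge-to (right y)           = ∧ʳ (edge-to y)
edge-to (below root)        = new
edge-to (below (nonroot y)) = dia (edge-to y)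

label-occurs : (y : NonRoot A) → OccursIn (label y) A
label-occurs (left y)            = ∧ˡ (label-occurs y)
label-occurs (right y)           = ∧ʳ (label-occurs y)
label-occurs (below root)        = here
label-occurs (below (nonroot y)) = dia (label-occurs y)

-- Edges are appended at the end because each non-root node has a unique incoming edge, so the
-- target determines the last step.
data Path (P : Pred Modality 0ℓ) (w : Node A) : Node A → Set where
  []   : Path P w w
  _∷ʳ_ : ∀ {y} → Path P w (parent y) → label y ∈ P → Path P w (nonroot y)

data Path⁺ (P : Pred Modality 0ℓ) (w : Node A) : Node A → Set where
  _∷ʳ_ : ∀ {y} → Path P w (parent y) → label y ∈ P → Path⁺ P w (nonroot y)

module _ {P Q : Pred Modality 0ℓ} where

  Path-map : P ⊆ Q → ∀ {w x : Node A} → Path P w x → Path Q w x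
  Path-map f []       = []
  Path-map f (p ∷ʳ a) = Path-map f p ∷ʳ f a

  Path⁺-map : P ⊆ Q → ∀ {w x : Node A} → Path⁺ P w x → Path⁺ Q w x
  Path⁺-map f (p ∷ʳ a) = Path-map f p ∷ʳ f a

  -- Both paths retrace the same chain of parents of `x`; the one exhausted first starts at the
  -- lower ancestor.
  ancestors-comparable : ∀ {v w x : Node A} → Path P v x → Path Q w x →
                         Path P v w ⊎ Path Q w v
  ancestors-comparable p        []       = inj₁ p
  ancestors-comparable []       q        = inj₂ q
  ancestors-comparable (p ∷ʳ _) (q ∷ʳ _) = ancestors-comparable p q

module _ {P : Pred Modality 0ℓ} where

  Path⁺⇒Path : ∀ {w x : Node A} → Path⁺ P w x → Path P w x
  Path⁺⇒Path (p ∷ʳ a) = p ∷ʳ a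

  _++_ : ∀ {v w x : Node A} → Path P v w → Path P w x → Path P v x
  p ++ []       = p
  p ++ (q ∷ʳ a) = (p ++ q) ∷ʳ a

  _++⁺_ : ∀ {v w x : Node A} → Path P v w → Path⁺ P w x → Path⁺ P v x
  p ++⁺ (q ∷ʳ a) = (p ++ q) ∷ʳ a

Explicit : (A : Formula) → Modality → Rel (Node A) 0ℓ
Explicit A γ x z = ∃[ w ] Path (γ <_) w x × Path⁺ (γ ≤_) w z

-- In `comp` and `eucl` two of the given paths end in the same node, so `v` and `w` are comparable
-- and the upper one is the new apex. In `eucl`, `β < α` turns labels at least `α` into labels above
-- `β`.
Explicit-isRCFrame : IsRCFrame S (λ γ _ → Explicit A γ)
Explicit-isRCFrame = record
  { comp = λ {α} {β} _ _ (v , p , q) (w , r , s) →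
      case ancestors-comparable (Path⁺⇒Path q) r of λ where
        (inj₁ vw) → v , Path-map (≤-<-trans (x⊓y≤x α β)) p
                  , Path-map (≤-trans (x⊓y≤x α β)) vw
                    ++⁺ Path⁺-map (≤-trans (x⊓y≤y α β)) s
        (inj₂ wv) → w , Path-map (≤-<-trans (x⊓y≤y α β)) wv
                        ++ Path-map (≤-<-trans (x⊓y≤x α β)) p
                  , Path⁺-map (≤-trans (x⊓y≤y α β)) s
  ; eucl = λ _ _ β<α (v , p , q) (w , r , s) →
      case ancestors-comparable p r of λ where
        (inj₁ vw) → v , Path-map (<-≤-trans β<α) (Path⁺⇒Path q)
                  , Path-map (<⇒≤ ∘ <-trans β<α) vw ++⁺ s
        (inj₂ wv) → w , wv ++ Path-map (<-≤-trans β<α) (Path⁺⇒Path q) , s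
  ; mono = λ _ _ β<α (w , p , q) →
      w , Path-map (<-trans β<α) p , Path⁺-map (≤-trans (<⇒≤ β<α)) q
  }

-- The functions `inˡ` and `inʳ` in the indices of `Edge` can block matching on an edge with given
-- endpoints, so edges are inverted through their target.
Edge⇒parent-label : ∀ {x y} → Edge A α x y →
  Σ[ y′ ∈ NonRoot A ] y ≡ nonroot y′ × x ≡ parent y′ × α ≡ label y′
Edge⇒parent-label (∧ˡ e) with Edge⇒parent-label e
... | _ , refl , refl , refl = _ , refl , refl , refl
Edge⇒parent-label (∧ʳ e) with Edge⇒parent-label e
... | _ , refl , refl , refl = _ , refl , refl , refl
Edge⇒parent-label (dia e) with Edge⇒parent-label e
... | _ , refl , refl , refl = _ , refl , refl , refl
Edge⇒parent-label new = _ , refl , refl , refl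

Edge⇒Path⁺ : ∀ {x y} → Edge A α x y → Path⁺ (α ≤_) x y
Edge⇒Path⁺ e with Edge⇒parent-label e
... | _ , refl , refl , refl = [] ∷ʳ ≤-refl

Closure⇒Explicit : .(α ∈ S) → ∀ {x y} → Closure S (λ γ _ → Edge A γ) α x y →
                   Explicit A α x y
Closure⇒Explicit {S = S} {A = A} =
  RCClosure-least {S} {R′ = λ γ _ → Explicit A γ} Explicit-isRCFrame
    (λ _ e → _ , [] , Edge⇒Path⁺ e)

-- Change of signature

module _ {A : Formula} {S : Signature} (ℓA⊆S : ∀ {α} → OccursIn α A → α ∈ S) where

  private
    R : Modality → Rel (Node A) 0ℓ
    R = Closure S (λ α _ → Edge A α)

    label∈S : (y : NonRoot A) → label y ∈ S
    label∈S y = ℓA⊆S (label-occurs y)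

    R-edge-to : (y : NonRoot A) → R (label y) (parent y) (nonroot y)
    R-edge-to y = base (label∈S y) (edge-to y)

    R-edge-to-≤ : .(γ ∈ S) → (y : NonRoot A) → γ ≤ label y → R γ (parent y) (nonroot y)
    R-edge-to-≤ g y γ≤l with ≤⇒<∨≡ γ≤l
    ... | inj₁ γ<l  = mono (label∈S y) g γ<l (R-edge-to y)
    ... | inj₂ refl = R-edge-to y

    -- `comp` at equal indices makes `R γ` transitive, and `R γ` contains every edge labelled at
    -- least `γ`.
    descend : ∀ {v w x} → .(γ ∈ S) → Path (γ ≤_) v w → R γ w x → R γ v x
    descend g []             r = r
    descend g (_∷ʳ_ {y} p a) r =
      descend g p
        (subst (λ γ → R γ _ _) (⊓-idem _) (comp g g (R-edge-to-≤ g y a) r))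

    -- `eucl` carries `R γ`-successors from a parent to its child when the edge label exceeds `γ`;
    -- hence the strict inequality in `Explicit`.
    climb : ∀ {w x z} → .(γ ∈ S) → Path (γ <_) w x → R γ w z → R γ x z
    climb g []             r = r
    climb g (_∷ʳ_ {y} p a) r = eucl (label∈S y) g a (R-edge-to y) (climb g p r)

  Explicit⇒Closure : ∀ {x y} → .(γ ∈ S) → Explicit A γ x y → R γ x y
  Explicit⇒Closure g (_ , p , (_∷ʳ_ {y} q a)) =
    climb g p (descend g q (R-edge-to-≤ g y a))

  -- The second path is nonempty and its last label can only be `ω`, so `ω` occurs in `A`. This
  -- recovers the membership proof that the valuation of `RCω S A` asks for.
  ω-Explicit⇒ω∈S : ∀ {x y} → Explicit A ω x y → ω ∈ S
  ω-Explicit⇒ω∈S (_ , _ , (_∷ʳ_ {y} _ a)) = subst (_∈ S) (ω≤⇒≡ω a) (label∈S y)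
    where
    ω≤⇒≡ω : ω ≤ β → β ≡ ω
    ω≤⇒≡ω (_ NonStrict.≤⊤⁺) = refl

  RCω-restrict : ∀ B → (∀ {α} → OccursIn α B → α ∈ S) →
                 ∀ {x} → RCω U A , x ⊩ B → RCω S A , x ⊩ B
  RCω-restrict (var p)   i (inj₁ v)               = inj₁ v
  RCω-restrict (var p)   i (inj₂ (_ , y , r , v)) =
    let e = Closure⇒Explicit tt r ; s = ω-Explicit⇒ω∈S e in
    inj₂ (s , y , Explicit⇒Closure s e , v)
  RCω-restrict ⊤         i f                      = tt
  RCω-restrict (B ∧ C)   i (f , g)                =
    RCω-restrict B (i ∘ ∧ˡ) f , RCω-restrict C (i ∘ ∧ʳ) g
  RCω-restrict (⟨ α ⟩ B) i (_ , y , r , f)        =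
    i here , y , Explicit⇒Closure (i here) (Closure⇒Explicit tt r)
           , RCω-restrict B (i ∘ dia) f

-- Soundness

module _ (M : Model U) (isRCFrame : IsRCFrame U (Model.R M))
         (V-persistent : ∀ {x y p} → Model.R M ω tt x y → Model.V M y p → Model.V M x p)
         where

  open Model M

  private
    module F = IsRCFrame isRCFrame

    compʳ : ∀ {x y z} → β ≤ α → R α tt x y → R β tt y z → R β tt x z
    compʳ β≤α p q = subst (λ γ → R γ tt _ _) (x≤y⇒y⊓x≈x β≤α) (F.comp tt tt p q)

    compˡ : ∀ {x y z} → β ≤ α → R β tt x y → R α tt y z → R β tt x z
    compˡ β≤α p q = subst (λ γ → R γ tt _ _) (x≤y⇒x⊓y≈x β≤α) (F.comp tt tt p q)

  -- This is the semantic content of `⊢-ω`. In the diamond case, an `R ω` step followed by an `R α`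
  -- step is an `R α` step.
  ⊩-persistent : ∀ A {x y} → R ω tt x y → M , y ⊩ A → M , x ⊩ A
  ⊩-persistent (var p)   r v               = V-persistent r v
  ⊩-persistent ⊤         r _               = tt
  ⊩-persistent (A ∧ B)   r (f , g)         = ⊩-persistent A r f , ⊩-persistent B r g
  ⊩-persistent (⟨ α ⟩ A) r (_ , z , q , f) = tt , z , compʳ (α NonStrict.≤⊤⁺) r q , f

  sound : A ⊢ B → ∀ {x} → M , x ⊩ A → M , x ⊩ B
  sound ⊢-refl        f                              = f
  sound ⊢-⊤           _                              = tt
  sound (⊢-cut d e)   f                              = sound e (sound d f)
  sound ⊢-∧ˡ          (f , _)                        = f
  sound ⊢-∧ʳ          (_ , g)                        = g
  sound (⊢-∧ d e)     f                              = sound d f , sound e f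
  sound (⊢-nec d)     (_ , y , r , f)                = tt , y , r , sound d f
  sound ⊢-trans       (_ , _ , r , _ , z , q , f)    = tt , z , compʳ ≤-refl r q , f
  sound (⊢-minʳ β≤α)  (_ , _ , r , _ , z , q , f)    = tt , z , compʳ β≤α r q , f
  sound (⊢-minˡ β≤α)  (_ , _ , r , _ , z , q , f)    = tt , z , compˡ β≤α r q , f
  sound (⊢-J β<α)     ((_ , y , r , f) , _ , z , q , g) =
    tt , y , r , f , tt , z , F.eucl tt tt β<α r q , g
  sound (⊢-mono β<α)  (_ , y , r , f)                = tt , y , F.mono tt tt β<α r , f
  sound (⊢-ω {A})     (_ , _ , r , f)                = ⊩-persistent A r f

module _ (M : Model U) where

  open Model M

  -- The map `h` is arbitrary so that the induction can restrict it to the trees of subformulas.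
  homomorphism⇒⊩ : ∀ A (h : Node A → W) →
                   (∀ {α x y} → Edge A α x y → R α tt (h x) (h y)) →
                   (∀ {x p} → TrueAt A x p → V (h x) p) →
                   M , h root ⊩ A
  homomorphism⇒⊩ (var p)   h e v = v var
  homomorphism⇒⊩ ⊤         h e v = tt
  homomorphism⇒⊩ (A ∧ B)   h e v =
    homomorphism⇒⊩ A (h ∘ inˡ) (e ∘ ∧ˡ) (v ∘ ∧ˡ) ,
    homomorphism⇒⊩ B (h ∘ inʳ) (e ∘ ∧ʳ) (v ∘ ∧ʳ)
  homomorphism⇒⊩ (⟨ α ⟩ A) h e v =
    tt , h (sub root) , e new , homomorphism⇒⊩ A (h ∘ sub) (e ∘ dia) (v ∘ dia)

RCω-root : ∀ A → RCω U A , root ⊩ A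
RCω-root A = homomorphism⇒⊩ (RCω U A) A (λ x → x) (base tt) inj₁

-- Since `R ω` is transitive, enlarging the valuation along one `ω` step already closes it.
RCω-persistent : ∀ {x y : Node A} {p} → let open Model (RCω U A) in
                 R ω tt x y → V y p → V x p
RCω-persistent r (inj₁ v)               = inj₂ (tt , _ , r , v)
RCω-persistent r (inj₂ (_ , z , q , v)) = inj₂ (tt , z , comp tt tt r q , v)

-- Completeness

⊢-∧-mono : ∀ {A′ B′} → A ⊢ A′ → B ⊢ B′ → A ∧ B ⊢ A′ ∧ B′
⊢-∧-mono d e = ⊢-∧ (⊢-cut ⊢-∧ˡ d) (⊢-cut ⊢-∧ʳ e)

⊢-∧-assocˡ : A ∧ (B ∧ C) ⊢ (A ∧ B) ∧ C
⊢-∧-assocˡ = ⊢-∧ (⊢-∧-mono ⊢-refl ⊢-∧ˡ) (⊢-cut ⊢-∧ʳ ⊢-∧ʳ)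

⊢-∧-assocʳ : (A ∧ B) ∧ C ⊢ A ∧ (B ∧ C)
⊢-∧-assocʳ = ⊢-∧ (⊢-cut ⊢-∧ˡ ⊢-∧ˡ) (⊢-∧-mono ⊢-∧ʳ ⊢-refl)

⊢-⊓ : ∀ α β → ⟨ α ⟩ ⟨ β ⟩ A ⊢ ⟨ α ⊓ β ⟩ A
⊢-⊓ {A} α β with ⊓-sel α β
... | inj₁ eq = subst (λ γ → ⟨ α ⟩ ⟨ β ⟩ A ⊢ ⟨ γ ⟩ A) (sym eq)
                  (⊢-minˡ (subst (_≤ β) eq (x⊓y≤y α β)))
... | inj₂ eq = subst (λ γ → ⟨ α ⟩ ⟨ β ⟩ A ⊢ ⟨ γ ⟩ A) (sym eq)
                  (⊢-minʳ (subst (_≤ α) eq (x⊓y≤x α β)))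

-- Finite conjunctions of formulas that `⊢-J` can move under `⟨ α ⟩`, with `⊤` as the empty
-- conjunction.
data Below (α : Modality) : Formula → Set where
  ⊤   : Below α ⊤
  _∧_ : Below α A → Below α B → Below α (A ∧ B)
  dia : β < α → Below α (⟨ β ⟩ A)

⊢-J-Below : Below α B → ⟨ α ⟩ A ∧ B ⊢ ⟨ α ⟩ (A ∧ B)
⊢-J-Below ⊤         = ⊢-cut ⊢-∧ˡ (⊢-nec (⊢-∧ ⊢-refl ⊢-⊤))
⊢-J-Below (b ∧ c)   =
  ⊢-cut ⊢-∧-assocˡ
    (⊢-cut (⊢-∧-mono (⊢-J-Below b) ⊢-refl)
      (⊢-cut (⊢-J-Below c) (⊢-nec ⊢-∧-assocʳ)))
⊢-J-Below (dia β<α) = ⊢-J β<α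

-- Theories and canonical relations

record IsTheory (F : Pred Formula 0ℓ) : Set where
  field
    ⊤-mem    : F ⊤
    ∧-closed : F A → F B → F (A ∧ B)
    ⊢-closed : A ⊢ B → F A → F B

open IsTheory

-- For a theory `F`, this is the least theory that contains `B` and every `⟨ β ⟩ D` in `F` with
-- `β < α`.
Successor : Modality → Formula → Pred Formula 0ℓ → Pred Formula 0ℓ
Successor α B F C = ∃[ E ] Below α E × F E × B ∧ E ⊢ C

-- The relation R_α between theories; it suffices to preserve the formulas ⟨ β ⟩ C
-- for β < α in one direction, the other one being derivable.
Canonical : Modality → Pred Formula 0ℓ → Pred Formula 0ℓ → Set
Canonical α F G = (∀ {C} → G C → F (⟨ α ⟩ C)) ×
                  (∀ {β C} → β < α → F (⟨ β ⟩ C) → G (⟨ β ⟩ C))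

module _ {F : Pred Formula 0ℓ} (t : IsTheory F) where

  Successor-isTheory : IsTheory (Successor α B F)
  Successor-isTheory = record
    { ⊤-mem    = ⊤ , ⊤ , ⊤-mem t , ⊢-⊤
    ; ∧-closed = λ (D , b , f , d) (E , c , g , e) →
        D ∧ E , b ∧ c , ∧-closed t f g
        , ⊢-∧ (⊢-cut (⊢-∧-mono ⊢-refl ⊢-∧ˡ) d) (⊢-cut (⊢-∧-mono ⊢-refl ⊢-∧ʳ) e)
    ; ⊢-closed = λ d (E , b , f , e) → E , b , f , ⊢-cut e d
    }

  Successor-mem : Successor α B F B
  Successor-mem = ⊤ , ⊤ , ⊤-mem t , ⊢-∧ˡ

  -- The witness `E` moves under the diamond, which puts `⟨ α ⟩ (B ∧ E)` in `F`; the second half is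
  -- built into `Successor`.
  Successor-canonical : F (⟨ α ⟩ B) → Canonical α F (Successor α B F)
  Successor-canonical f =
    (λ (E , b , g , d) →
      ⊢-closed t (⊢-cut (⊢-J-Below b) (⊢-nec d)) (∧-closed t f g)) ,
    (λ β<α g → _ , dia β<α , g , ⊢-∧ʳ)

mutual
  -- Both conjuncts receive the same `F`, as their roots are identified.
  theory : ∀ A → Pred Formula 0ℓ → Node A → Pred Formula 0ℓ
  theory A F root        = F
  theory A F (nonroot x) = theory⁻ A F x

  theory⁻ : ∀ A → Pred Formula 0ℓ → NonRoot A → Pred Formula 0ℓ
  theory⁻ (A ∧ B)   F (left x)  = theory⁻ A F x
  theory⁻ (A ∧ B)   F (right x) = theory⁻ B F x
  theory⁻ (⟨ α ⟩ A) F (below x) = theory A (Successor α A F) x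

-- Not definitional, because `inˡ` is stuck on a variable node.
theory-inˡ : ∀ {F} x → theory A F x ≡ theory (A ∧ B) F (inˡ x)
theory-inˡ root        = refl
theory-inˡ (nonroot x) = refl

theory-inʳ : ∀ {F} x → theory B F x ≡ theory (A ∧ B) F (inʳ x)
theory-inʳ root        = refl
theory-inʳ (nonroot x) = refl

mutual
  theory-isTheory : ∀ {F} → IsTheory F → (x : Node A) → IsTheory (theory A F x)
  theory-isTheory t root        = t
  theory-isTheory t (nonroot x) = theory⁻-isTheory t x

  theory⁻-isTheory : ∀ {F} → IsTheory F → (x : NonRoot A) → IsTheory (theory⁻ A F x)
  theory⁻-isTheory t (left x)  = theory⁻-isTheory t x
  theory⁻-isTheory t (right x) = theory⁻-isTheory t x
  theory⁻-isTheory t (below x) = theory-isTheory (Successor-isTheory t) x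

-- `F A` is the invariant of the descent: it passes to both conjuncts, and `Successor α B F`
-- contains `B`.
theory-edge : ∀ {F} → IsTheory F → F A → ∀ {x y} → Edge A α x y →
              Canonical α (theory A F x) (theory A F y)
theory-edge t f (∧ˡ {x = x} {y} e) =
  subst₂ (Canonical _) (theory-inˡ x) (theory-inˡ y)
    (theory-edge t (⊢-closed t ⊢-∧ˡ f) e)
theory-edge t f (∧ʳ {x = x} {y} e) =
  subst₂ (Canonical _) (theory-inʳ x) (theory-inʳ y)
    (theory-edge t (⊢-closed t ⊢-∧ʳ f) e)
theory-edge t f (dia e) = theory-edge (Successor-isTheory t) (Successor-mem t) e
theory-edge t f new     = Successor-canonical t f

theory-var : ∀ {F} → IsTheory F → F A → ∀ {x p} → TrueAt A x p → theory A F x (var p)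
theory-var t f var              = f
theory-var t f (∧ˡ {x = x} v) =
  subst (λ G → G (var _)) (theory-inˡ x) (theory-var t (⊢-closed t ⊢-∧ˡ f) v)
theory-var t f (∧ʳ {x = x} v) =
  subst (λ G → G (var _)) (theory-inʳ x) (theory-var t (⊢-closed t ⊢-∧ʳ f) v)
theory-var t f (dia v)          = theory-var (Successor-isTheory t) (Successor-mem t) v

Canonical-isRCFrame : {W : Set} (Φ : W → Pred Formula 0ℓ) → (∀ x → IsTheory (Φ x)) →
                      IsRCFrame S (λ α _ x y → Canonical α (Φ x) (Φ y))
Canonical-isRCFrame Φ t = record
  { comp = λ {α} {β} _ _ {x} (p , p′) (q , q′) →
      (λ c → ⊢-closed (t x) (⊢-⊓ α β) (p (q c))) ,
      (λ l c → q′ (<-≤-trans l (x⊓y≤y α β)) (p′ (<-≤-trans l (x⊓y≤x α β)) c))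
  ; eucl = λ _ _ β<α {x} (p , p′) (q , q′) →
      (λ c → p′ β<α (q c)) ,
      -- For δ below `β`, a formula `⟨ δ ⟩ C` at the middle node is pulled back to `x` as
      -- `⟨ α ⟩ ⟨ δ ⟩ C`, where `⊢-minʳ` drops the outer diamond.
      (λ l c → q′ l (⊢-closed (t x) (⊢-minʳ (<⇒≤ (<-trans l β<α))) (p c)))
  ; mono = λ _ _ β<α {x} (p , p′) →
      (λ c → ⊢-closed (t x) (⊢-mono β<α) (p c)) ,
      (λ l c → p′ (<-trans l β<α) c)
  }

-- From forcing to derivability

module _ (S : Signature) (A : Formula) where

  private
    Φ : Node A → Pred Formula 0ℓ
    Φ = theory A (A ⊢_)

    ⊢-isTheory : IsTheory (A ⊢_)
    ⊢-isTheory = record { ⊤-mem = ⊢-⊤ ; ∧-closed = ⊢-∧ ; ⊢-closed = λ d e → ⊢-cut e d }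

    Φ-isTheory : ∀ x → IsTheory (Φ x)
    Φ-isTheory = theory-isTheory ⊢-isTheory

    Φ-canonical : .(α ∈ S) → ∀ {x y} → Closure S (λ α _ → Edge A α) α x y →
                  Canonical α (Φ x) (Φ y)
    Φ-canonical = RCClosure-least {S} {R′ = λ α _ x y → Canonical α (Φ x) (Φ y)}
      (Canonical-isRCFrame Φ Φ-isTheory) (λ _ → theory-edge ⊢-isTheory ⊢-refl)

  -- At the root `Φ` is `A ⊢_`, so this yields `A ⊢ B`.
  ⊩⇒theory : ∀ B {x} → RCω S A , x ⊩ B → Φ x B
  ⊩⇒theory (var p)   (inj₁ v)                   = theory-var ⊢-isTheory ⊢-refl v
  ⊩⇒theory (var p)   {x} (inj₂ (s , y , r , v)) =
    -- The extra clause of the valuation only gives `⟨ ω ⟩ var p` in the theory of `x`; `⊢-ω`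
    -- removes the diamond.
    ⊢-closed (Φ-isTheory x) ⊢-ω
      (proj₁ (Φ-canonical s r) (theory-var ⊢-isTheory ⊢-refl v))
  ⊩⇒theory ⊤         {x} _                      = ⊤-mem (Φ-isTheory x)
  ⊩⇒theory (B ∧ C)   {x} (f , g)                =
    ∧-closed (Φ-isTheory x) (⊩⇒theory B f) (⊩⇒theory C g)
  ⊩⇒theory (⟨ α ⟩ B) (s , y , r , f)            =
    proj₁ (Φ-canonical s r) (⊩⇒theory B f)

theorem5p5 : (A B : Formula) → (A ⊢ B) ⇔ (RCω (ℓ (｛ A ｝ ∪ ｛ B ｝)) A , root ⊩ B)
theorem5p5 A B = mk⇔
  (λ d → RCω-restrict (λ o → A , inj₁ refl , o) B (λ o → B , inj₂ refl , o)
    (sound (RCω U A) (RCClosure-isRCFrame _) RCω-persistent d (RCω-root A)))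
  (⊩⇒theory _ A B)
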